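{- $\mathcal{L}_{\rm V}(\mathbb{RDMP}) \cong \mathcal{L}_{\rm V}(\mathbb{RDMH}) \cong \mathcal{L}_{\rm V}(\mathbb{RDMDBLH}) \cong \mathcal{L}_{\rm V}(\mathbb{RDMDBLP})$ (isomorphism of lattices), where $\mathcal{L}_{\rm V}(\mathbb V)$ denotes the lattice of subvarieties of the variety $\mathbb V$, ordered by inclusion.
   Context: A De Morgan algebra is a bounded distributive lattice with a unary operation ${}'$ satisfying $x''\approx x$, $(x\vee y)'\approx x'\wedge y'$, $(x\wedge y)'\approx x'\vee y'$, $0'\approx1$, $1'\approx0$. All algebras below have a De Morgan algebra reduct $\langle A,\vee,\wedge,{}',0,1\rangle$. Notation for the further operations: $x^*$ is the largest $z$ with $x\wedge z=0$; $x^+$ is the least $z$ with $x\vee z=1$; $x\to y$ is the largest $z$ with $x\wedge z\le y$; $x\leftarrow y$ is the least $z$ with $y\le x\vee z$. Where ${}^*$ is not basic, $x^*:=x\to0$. The regularity identity is (M1): $(x\wedge x'{}^*{}')\vee(y\vee y^*)\approx y\vee y^*$, where $x'{}^*{}'=((x')^*)'$. $\mathbb{RDMP}$ (regular De Morgan p-algebras): algebras $\langle A,\vee,\wedge,{}^*,{}',0,1\rangle$ satisfying (M1). $\mathbb{RDMH}$ (regular De Morgan Heyting algebras): algebras $\langle A,\vee,\wedge,\to,{}',0,1\rangle$ satisfying (M1). $\mathbb{RDMDBLH}$ (regular De Morgan double Heyting algebras): algebras $\langle A,\vee,\wedge,\to,\leftarrow,{}',0,1\rangle$ satisfying (M1).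 $\mathbb{RDMDBLP}$ (regular De Morgan double p-algebras): algebras $\langle A,\vee,\wedge,{}^*,{}^+,{}',0,1\rangle$ satisfying (M1). -}

module Defs where

open import Level using (Level; _⊔_; Lift; lift; lower) renaming (zero to 0ℓ; suc to lsuc)
open import Algebra.Lattice.Bundles using () renaming (Lattice to AlgLattice)
open import Algebra.Lattice.Morphism.Structures using (module LatticeMorphisms)
open import Algebra.Lattice.Structures using (IsDistributiveLattice)
import Algebra.Lattice.Properties.Lattice as LatticeProperties
open import Data.List.Base using (List; []; _∷_)
open import Data.List.Membership.Propositional using (_∈_)
open import Data.List.Relation.Unary.All using (All; []; _∷_)
import Data.List.Relation.Unary.All as All
open import Data.Nat.Base using (ℕ; zero; suc)
open import Data.Product.Base using (Σ-syntax; ∃-syntax; _×_; _,_; proj₁; proj₂)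
open import Data.Sum.Base using (_⊎_; inj₁; inj₂; [_,_])
open import Data.Vec.Base using (Vec; []; _∷_)
open import Data.Vec.Relation.Binary.Pointwise.Inductive
  using (Pointwise; []; _∷_; Pointwise-≡⇒≡)
open import Function.Base using (_∘_)
open import Function.Bundles using (_⇔_; mk⇔; Equivalence)
open import Relation.Binary.Bundles using (Setoid)
open import Relation.Binary.Core using (Rel)
open import Relation.Binary.Definitions using (Minimum; Maximum)
import Relation.Binary.Construct.NaturalOrder.Left as NaturalOrder
open import Relation.Binary.Lattice.Bundles using (Lattice)
open import Relation.Binary.Lattice.Properties.Lattice using (algLattice)
import Relation.Binary.Lattice as R
open import Relation.Binary.PropositionalEquality using (_≡_; cong; setoid)
open import Relation.Unary using (Pred; _∩_; _∪_; _⊆′_; _≐′_)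

open Equivalence using (to; from)

private
  variable
    c ℓ k p : Level

record Signature : Set₁ where
  field
    Op    : Set
    arity : Op → ℕ

open Signature public

_⊕_ : Signature → Signature → Signature
S ⊕ T = record { Op = Op S ⊎ Op T ; arity = [ arity S , arity T ] }

record Algebra (S : Signature) (c ℓ : Level) : Set (lsuc (c ⊔ ℓ)) where
  field
    carrier : Setoid c ℓ
  open Setoid carrier public
  field
    ⟦_⟧    : (f : Op S) → Vec Carrier (arity S f) → Carrier
    ⟦⟧-cong : ∀ f {xs ys} → Pointwise _≈_ xs ys → ⟦ f ⟧ xs ≈ ⟦ f ⟧ ys

reduct : ∀ {S T} → Algebra (S ⊕ T) c ℓ → Algebra S c ℓ
reduct A = record
  { carrier = carrier
  ; ⟦_⟧     = λ f → ⟦ inj₁ f ⟧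
  ; ⟦⟧-cong = λ f → ⟦⟧-cong (inj₁ f)
  }
  where open Algebra A

data Term (S : Signature) : Set where
  var : ℕ → Term S
  app : (f : Op S) → Vec (Term S) (arity S f) → Term S

termAlgebra : (S : Signature) → Algebra S 0ℓ 0ℓ
termAlgebra S = record
  { carrier = setoid (Term S)
  ; ⟦_⟧     = app
  ; ⟦⟧-cong = λ f ts≡us → cong (app f) (Pointwise-≡⇒≡ ts≡us)
  }

module _ {S : Signature} (A : Algebra S c ℓ) where
  open Algebra A

  mutual
    eval : (ℕ → Carrier) → Term S → Carrier
    eval ρ (var i)    = ρ i
    eval ρ (app f ts) = ⟦ f ⟧ (evals ρ ts)

    evals : ∀ {n} → (ℕ → Carrier) → Vec (Term S) n → Vec Carrier n
    evals ρ []       = []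
    evals ρ (t ∷ ts) = eval ρ t ∷ evals ρ ts

Identity : Signature → Set
Identity S = Term S × Term S

infix 4 _⊨_ _⊨*_

_⊨_ : ∀ {S} → Algebra S c ℓ → Identity S → Set (c ⊔ ℓ)
A ⊨ (s , t) = ∀ ρ → eval A ρ s ≈ eval A ρ t
  where open Algebra A

_⊨*_ : ∀ {S} → Algebra S c ℓ → Pred (Identity S) k → Set (c ⊔ ℓ ⊔ k)
A ⊨* E = ∀ e → E e → A ⊨ e

-- Sets of identities are allowed to live one universe above the algebras, so
-- that the equational theory of a class of algebras is itself such a set.
-- A variety is an equational class; the variables of identities range over ℕ.
IsVariety : ∀ {S} → Pred (Algebra S c ℓ) k → Set (lsuc (lsuc (c ⊔ ℓ)) ⊔ k)
IsVariety {c} {ℓ} {S = S} K =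
  Σ[ E ∈ Pred (Identity S) (lsuc (c ⊔ ℓ)) ] (∀ A → K A ⇔ A ⊨* E)

record Variety (S : Signature) (c ℓ k : Level) : Set (lsuc (lsuc (c ⊔ ℓ)) ⊔ lsuc k) where
  field
    class     : Pred (Algebra S c ℓ) k
    isVariety : IsVariety class

open Variety public

Theory : ∀ {S} → Pred (Algebra S c ℓ) k → Pred (Identity S) (lsuc (c ⊔ ℓ) ⊔ k)
Theory K e = ∀ A → K A → A ⊨ e

record Subvariety {S : Signature} (V : Variety S c ℓ k) : Set (lsuc (lsuc (c ⊔ ℓ)) ⊔ k) where
  field
    variety : Variety S c ℓ (lsuc (c ⊔ ℓ))
    ⊆V      : class variety ⊆′ class V
  open Variety variety public renaming (class to members; isVariety to members-isVariety)

open Subvariety public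

module _ {S : Signature} (V : Variety S c ℓ k) where

  private
    sup : Subvariety V → Subvariety V → Subvariety V
    sup P Q = record
      { variety = record
        { class     = λ A → A ⊨* Theory (members P ∪ members Q)
        ; isVariety = Theory (members P ∪ members Q) , λ A → mk⇔ (λ m → m) (λ m → m)
        }
      ; ⊆V = λ A m → from (proj₂ (isVariety V) A) λ e e∈E → m e λ where
          B (inj₁ b) → to (proj₂ (isVariety V) B) (⊆V P B b) e e∈E
          B (inj₂ b) → to (proj₂ (isVariety V) B) (⊆V Q B b) e e∈E
      }

    inf : Subvariety V → Subvariety V → Subvariety V
    inf P Q = record
      { variety = record
        { class     = members P ∩ members Q
        ; isVariety = (proj₁ (members-isVariety P) ∪ proj₁ (members-isVariety Q)) , λ A → mk⇔
            (λ where (a , b) e (inj₁ i) → to (proj₂ (members-isVariety P) A) a e i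
                     (a , b) e (inj₂ i) → to (proj₂ (members-isVariety Q) A) b e i)
            (λ m → from (proj₂ (members-isVariety P) A) (λ e i → m e (inj₁ i))
                 , from (proj₂ (members-isVariety Q) A) (λ e i → m e (inj₂ i)))
        }
      ; ⊆V = λ A m → ⊆V P A (proj₁ m)
      }

  -- Subvarieties are ordered by inclusion and identified when they have the
  -- same members; the join of two is axiomatised by the identities true in both.
  𝓛ᵥ : Lattice (lsuc (lsuc (c ⊔ ℓ)) ⊔ k) (lsuc (c ⊔ ℓ)) (lsuc (c ⊔ ℓ))
  𝓛ᵥ = record
    { Carrier   = Subvariety V
    ; _≈_       = λ P Q → members P ≐′ members Q
    ; _≤_       = λ P Q → members P ⊆′ members Q
    ; _∨_       = sup
    ; _∧_       = inf
    ; isLattice = record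
      { isPartialOrder = record
        { isPreorder = record
          { isEquivalence = record
            { refl  = (λ _ a → a) , (λ _ a → a)
            ; sym   = λ (f , g) → g , f
            ; trans = λ (f , g) (f′ , g′) → (λ A → f′ A ∘ f A) , (λ A → g A ∘ g′ A)
            }
          ; reflexive = proj₁
          ; trans     = λ f g A → g A ∘ f A
          }
        ; antisym = _,_
        }
      ; supremum = λ P Q
          → (λ A a e th → th A (inj₁ a))
          , (λ A a e th → th A (inj₂ a))
          , λ T P≤T Q≤T A m → from (proj₂ (members-isVariety T) A) λ e i → m e λ where
              B (inj₁ b) → to (proj₂ (members-isVariety T) B) (P≤T B b) e i
              B (inj₂ b) → to (proj₂ (members-isVariety T) B) (Q≤T B b) e i
      ; infimum = λ P Q
          → (λ A → proj₁)
          , (λ A → proj₂)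
          , λ T T≤P T≤Q A t → T≤P A t , T≤Q A t
      }
    }

infix 4 _≅_

_≅_ : ∀ {a b ℓ₁ ℓ₂ ℓ₃ ℓ₄} → Lattice a ℓ₁ ℓ₂ → Lattice b ℓ₃ ℓ₄ → Set (a ⊔ b ⊔ ℓ₁ ⊔ ℓ₃)
L ≅ M = ∃[ f ] IsLatticeIsomorphism f
  where
  open LatticeMorphisms (AlgLattice.rawLattice (algLattice L)) (AlgLattice.rawLattice (algLattice M))

data DMOp : Set where
  join meet neg bot top : DMOp

DM : Signature
DM = record { Op = DMOp ; arity = λ where join → 2 ; meet → 2 ; neg → 1 ; bot → 0 ; top → 0 }

module DMOperations (A : Algebra DM c ℓ) where
  open Algebra A public

  infixr 7 _∧_
  infixr 6 _∨_
  infix  8 _′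

  _∨_ _∧_ : Carrier → Carrier → Carrier
  x ∨ y = ⟦ join ⟧ (x ∷ y ∷ [])
  x ∧ y = ⟦ meet ⟧ (x ∷ y ∷ [])

  _′ : Carrier → Carrier
  x ′ = ⟦ neg ⟧ (x ∷ [])

  𝟎 𝟏 : Carrier
  𝟎 = ⟦ bot ⟧ []
  𝟏 = ⟦ top ⟧ []

  -- x ≤ y means x ≈ x ∧ y
  open NaturalOrder _≈_ _∧_ public using (_≤_)

record IsDeMorgan (A : Algebra DM c ℓ) : Set (c ⊔ ℓ) where
  open DMOperations A
  field
    isDistributiveLattice : IsDistributiveLattice _≈_ _∨_ _∧_
    𝟎-minimum             : Minimum _≤_ 𝟎
    𝟏-maximum             : Maximum _≤_ 𝟏
    ′-involutive          : ∀ x → x ′ ′ ≈ x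
    ′-∨                   : ∀ x y → (x ∨ y) ′ ≈ x ′ ∧ y ′
    ′-∧                   : ∀ x y → (x ∧ y) ′ ≈ x ′ ∨ y ′
    𝟎′≈𝟏                  : 𝟎 ′ ≈ 𝟏
    𝟏′≈𝟎                  : 𝟏 ′ ≈ 𝟎

module _ {c ℓ} (A : Algebra DM c ℓ) where
  open DMOperations A

  IsLargest IsLeast : ∀ {p} → Pred Carrier p → Pred Carrier (c ⊔ ℓ ⊔ p)
  IsLargest P m = P m × (∀ z → P z → z ≤ m)
  IsLeast   P m = P m × (∀ z → P z → m ≤ z)

  IsPseudocomplement IsDualPseudocomplement : (Carrier → Carrier) → Set (c ⊔ ℓ)
  IsPseudocomplement     _* = ∀ x → IsLargest (λ z → x ∧ z ≈ 𝟎) (x *)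
  IsDualPseudocomplement _⁺ = ∀ x → IsLeast (λ z → x ∨ z ≈ 𝟏) (x ⁺)

  IsImplication IsDualImplication : (Carrier → Carrier → Carrier) → Set (c ⊔ ℓ)
  IsImplication     _⇨_ = ∀ x y → IsLargest (λ z → x ∧ z ≤ y) (x ⇨ y)
  IsDualImplication _⇦_ = ∀ x y → IsLeast (λ z → y ≤ x ∨ z) (x ⇦ y)

  -- The two sides of the regularity identity, as term operations, so that they
  -- can be read both in an algebra and in the term algebra.
  regˡ regʳ : (Carrier → Carrier) → Carrier → Carrier → Carrier
  regˡ _* x y = (x ∧ (((x ′) *) ′)) ∨ (y ∨ (y *))
  regʳ _* x y = y ∨ (y *)

  IsRegular : (Carrier → Carrier) → Set (c ⊔ ℓ)
  IsRegular _* = ∀ x y → regˡ _* x y ≈ regʳ _* x y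

data POp : Set where
  star : POp

data HOp : Set where
  imp : HOp

data DblHOp : Set where
  imp dimp : DblHOp

data DblPOp : Set where
  star plus : DblPOp

DMP DMH DMDblH DMDblP : Signature
DMP    = DM ⊕ record { Op = POp    ; arity = λ _ → 1 }
DMH    = DM ⊕ record { Op = HOp    ; arity = λ _ → 2 }
DMDblH = DM ⊕ record { Op = DblHOp ; arity = λ _ → 2 }
DMDblP = DM ⊕ record { Op = DblPOp ; arity = λ _ → 1 }

module DMPOperations (A : Algebra DMP c ℓ) where
  open DMOperations (reduct A) public
  infix 8 _*
  _* : Carrier → Carrier
  x * = Algebra.⟦_⟧ A (inj₂ star) (x ∷ [])

module DMHOperations (A : Algebra DMH c ℓ) where
  open DMOperations (reduct A) public
  infixr 5 _⇨_
  infix  8 _*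
  _⇨_ : Carrier → Carrier → Carrier
  x ⇨ y = Algebra.⟦_⟧ A (inj₂ imp) (x ∷ y ∷ [])
  _* : Carrier → Carrier
  x * = x ⇨ 𝟎

module DMDblHOperations (A : Algebra DMDblH c ℓ) where
  open DMOperations (reduct A) public
  infixr 5 _⇨_ _⇦_
  infix  8 _*
  _⇨_ _⇦_ : Carrier → Carrier → Carrier
  x ⇨ y = Algebra.⟦_⟧ A (inj₂ imp) (x ∷ y ∷ [])
  x ⇦ y = Algebra.⟦_⟧ A (inj₂ dimp) (x ∷ y ∷ [])
  _* : Carrier → Carrier
  x * = x ⇨ 𝟎

module DMDblPOperations (A : Algebra DMDblP c ℓ) where
  open DMOperations (reduct A) public
  infix 8 _* _⁺
  _* _⁺ : Carrier → Carrier
  x * = Algebra.⟦_⟧ A (inj₂ star) (x ∷ [])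
  x ⁺ = Algebra.⟦_⟧ A (inj₂ plus) (x ∷ [])

IsRDMP : Pred (Algebra DMP c ℓ) (c ⊔ ℓ)
IsRDMP A = IsDeMorgan (reduct A) × IsPseudocomplement (reduct A) _* × IsRegular (reduct A) _*
  where open DMPOperations A

IsRDMH : Pred (Algebra DMH c ℓ) (c ⊔ ℓ)
IsRDMH A = IsDeMorgan (reduct A) × IsImplication (reduct A) _⇨_ × IsRegular (reduct A) _*
  where open DMHOperations A

IsRDMDblH : Pred (Algebra DMDblH c ℓ) (c ⊔ ℓ)
IsRDMDblH A = IsDeMorgan (reduct A) × IsImplication (reduct A) _⇨_
            × IsDualImplication (reduct A) _⇦_ × IsRegular (reduct A) _*
  where open DMDblHOperations A

IsRDMDblP : Pred (Algebra DMDblP c ℓ) (c ⊔ ℓ)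
IsRDMDblP A = IsDeMorgan (reduct A) × IsPseudocomplement (reduct A) _*
            × IsDualPseudocomplement (reduct A) _⁺ × IsRegular (reduct A) _*
  where open DMDblPOperations A

_⊨ᴸ_ : ∀ {S} → Algebra S c ℓ → List (Identity S) → Set (c ⊔ ℓ)
A ⊨ᴸ es = All (A ⊨_) es

finitely-based : ∀ {S} {K : Pred (Algebra S c ℓ) k} (es : List (Identity S)) →
                 (∀ A → K A ⇔ A ⊨ᴸ es) → IsVariety K
finitely-based es K⇔es = (λ e → Lift _ (e ∈ es)) , λ A → mk⇔
  (λ a e e∈ → All.lookup (to (K⇔es A) a) (lower e∈))
  (λ m → from (K⇔es A) (All.tabulate λ {e} e∈ → m e (lift e∈)))

relative : ∀ {S} {K : Pred (Algebra S c ℓ) k} {P : Pred (Algebra S c ℓ) p} →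
           IsVariety K → (es : List (Identity S)) →
           (∀ A → K A → P A ⇔ A ⊨ᴸ es) → IsVariety (K ∩ P)
relative {c} {ℓ} (E , K⇔E) es P⇔es = (E ∪ λ e → Lift (lsuc (c ⊔ ℓ)) (e ∈ es)) , λ A → mk⇔
  (λ where (a , b) e (inj₁ i) → to (K⇔E A) a e i
           (a , b) e (inj₂ i) → All.lookup (to (P⇔es A a) b) (lower i))
  (λ m → let a = from (K⇔E A) (λ e i → m e (inj₁ i))
         in a , from (P⇔es A a) (All.tabulate λ {e} i → m e (inj₂ (lift i))))

env : {A : Set c} → A → A → A → ℕ → A
env x y z 0             = x
env x y z 1             = y
env x y z (suc (suc _)) = z

x₀ y₀ z₀ : ∀ {S} → Term S
x₀ = var 0
y₀ = var 1
z₀ = var 2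

module _ {T : Signature} where
  open DMOperations (reduct {T = T} (termAlgebra (DM ⊕ T)))

  deMorgan-axioms : List (Identity (DM ⊕ T))
  deMorgan-axioms
    = (x₀ ∨ y₀ , y₀ ∨ x₀)
    ∷ ((x₀ ∨ y₀) ∨ z₀ , x₀ ∨ (y₀ ∨ z₀))
    ∷ (x₀ ∧ y₀ , y₀ ∧ x₀)
    ∷ ((x₀ ∧ y₀) ∧ z₀ , x₀ ∧ (y₀ ∧ z₀))
    ∷ (x₀ ∨ (x₀ ∧ y₀) , x₀)
    ∷ (x₀ ∧ (x₀ ∨ y₀) , x₀)
    ∷ (x₀ ∨ (y₀ ∧ z₀) , (x₀ ∨ y₀) ∧ (x₀ ∨ z₀))
    ∷ ((y₀ ∧ z₀) ∨ x₀ , (y₀ ∨ x₀) ∧ (z₀ ∨ x₀))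
    ∷ (x₀ ∧ (y₀ ∨ z₀) , (x₀ ∧ y₀) ∨ (x₀ ∧ z₀))
    ∷ ((y₀ ∨ z₀) ∧ x₀ , (y₀ ∧ x₀) ∨ (z₀ ∧ x₀))
    ∷ (𝟎 , 𝟎 ∧ x₀)
    ∷ (x₀ , x₀ ∧ 𝟏)
    ∷ (x₀ ′ ′ , x₀)
    ∷ ((x₀ ∨ y₀) ′ , x₀ ′ ∧ y₀ ′)
    ∷ ((x₀ ∧ y₀) ′ , x₀ ′ ∨ y₀ ′)
    ∷ (𝟎 ′ , 𝟏)
    ∷ (𝟏 ′ , 𝟎)
    ∷ []

deMorgan-isVariety : ∀ {T} → IsVariety {c} {ℓ} {S = DM ⊕ T} (IsDeMorgan ∘ reduct)
deMorgan-isVariety = finitely-based deMorgan-axioms λ A → mk⇔ (fwd A) (bwd A)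
  where
  fwd : ∀ {T} (A : Algebra (DM ⊕ T) c ℓ) → IsDeMorgan (reduct A) → A ⊨ᴸ deMorgan-axioms
  fwd A dm
    = (λ ρ → ∨-comm (ρ 0) (ρ 1))
    ∷ (λ ρ → ∨-assoc (ρ 0) (ρ 1) (ρ 2))
    ∷ (λ ρ → ∧-comm (ρ 0) (ρ 1))
    ∷ (λ ρ → ∧-assoc (ρ 0) (ρ 1) (ρ 2))
    ∷ (λ ρ → ∨-absorbs-∧ (ρ 0) (ρ 1))
    ∷ (λ ρ → ∧-absorbs-∨ (ρ 0) (ρ 1))
    ∷ (λ ρ → ∨-distribˡ-∧ (ρ 0) (ρ 1) (ρ 2))
    ∷ (λ ρ → ∨-distribʳ-∧ (ρ 0) (ρ 1) (ρ 2))
    ∷ (λ ρ → ∧-distribˡ-∨ (ρ 0) (ρ 1) (ρ 2))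
    ∷ (λ ρ → ∧-distribʳ-∨ (ρ 0) (ρ 1) (ρ 2))
    ∷ (λ ρ → 𝟎-minimum (ρ 0))
    ∷ (λ ρ → 𝟏-maximum (ρ 0))
    ∷ (λ ρ → ′-involutive (ρ 0))
    ∷ (λ ρ → ′-∨ (ρ 0) (ρ 1))
    ∷ (λ ρ → ′-∧ (ρ 0) (ρ 1))
    ∷ (λ ρ → 𝟎′≈𝟏)
    ∷ (λ ρ → 𝟏′≈𝟎)
    ∷ []
    where
    open IsDeMorgan dm
    open IsDistributiveLattice isDistributiveLattice

  bwd : ∀ {T} (A : Algebra (DM ⊕ T) c ℓ) → A ⊨ᴸ deMorgan-axioms → IsDeMorgan (reduct A)
  bwd A (a₁ ∷ a₂ ∷ a₃ ∷ a₄ ∷ a₅ ∷ a₆ ∷ a₇ ∷ a₈ ∷ a₉ ∷ a₁₀ ∷ a₁₁ ∷ a₁₂ ∷ a₁₃ ∷ a₁₄ ∷ a₁₅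
         ∷ a₁₆ ∷ a₁₇ ∷ []) = record
    { isDistributiveLattice = record
      { isLattice = record
        { isEquivalence = isEquivalence
        ; ∨-comm        = λ x y → a₁ (env x y y)
        ; ∨-assoc       = λ x y z → a₂ (env x y z)
        ; ∨-cong        = λ p q → ⟦⟧-cong join (p ∷ q ∷ [])
        ; ∧-comm        = λ x y → a₃ (env x y y)
        ; ∧-assoc       = λ x y z → a₄ (env x y z)
        ; ∧-cong        = λ p q → ⟦⟧-cong meet (p ∷ q ∷ [])
        ; absorptive    = (λ x y → a₅ (env x y y)) , (λ x y → a₆ (env x y y))
        }
      ; ∨-distrib-∧ = (λ x y z → a₇ (env x y z)) , (λ x y z → a₈ (env x y z))
      ; ∧-distrib-∨ = (λ x y z → a₉ (env x y z)) , (λ x y z → a₁₀ (env x y z))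
      }
    ; 𝟎-minimum    = λ x → a₁₁ (env x x x)
    ; 𝟏-maximum    = λ x → a₁₂ (env x x x)
    ; ′-involutive = λ x → a₁₃ (env x x x)
    ; ′-∨          = λ x y → a₁₄ (env x y y)
    ; ′-∧          = λ x y → a₁₅ (env x y y)
    ; 𝟎′≈𝟏         = a₁₆ (env 𝟎 𝟎 𝟎)
    ; 𝟏′≈𝟎         = a₁₇ (env 𝟎 𝟎 𝟎)
    }
    where open DMOperations (reduct A)

-- The extremal properties are first-order implications; over De Morgan algebras
-- each is equivalent to identities: the extremal element satisfies the condition,
-- and the condition is forced on an arbitrary z by a lattice substitution (for
-- example y is replaced by (x ∧ z) ∨ y, which is y itself when x ∧ z ≤ y).
module Residuals (A : Algebra DM c ℓ) (dm : IsDeMorgan A) where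
  open DMOperations A
  open IsDeMorgan dm
  open IsDistributiveLattice isDistributiveLattice
    using (isLattice; ∧-comm; ∧-assoc; ∧-congˡ; ∨-comm; ∨-assoc; ∨-congˡ; ∨-absorbs-∧)
  private
    L : AlgLattice _ _
    L = record { isLattice = isLattice }
  open LatticeProperties L using (∨-∧-orderTheoreticLattice)
  open R.Lattice ∨-∧-orderTheoreticLattice
    using (x∧y≤y; x≤x∨y; antisym)
    renaming (trans to ≤-trans; reflexive to ≤-reflexive)

  ≤⇒∨≈ : ∀ {x y} → x ≤ y → x ∨ y ≈ y
  ≤⇒∨≈ {x} {y} x≤y = trans (∨-comm x y)
    (trans (∨-congˡ (trans x≤y (∧-comm x y))) (∨-absorbs-∧ y x))

  module _ (_* : Carrier → Carrier) (*-cong : ∀ {x y} → x ≈ y → (x *) ≈ (y *)) where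

    pseudocomplement :
      IsPseudocomplement A _* ⇔
      ((∀ x → x ∧ (x *) ≈ 𝟎) × ((𝟎 *) ≈ 𝟏) × (∀ x z → z ∧ ((x ∧ z) *) ≤ (x *)))
    pseudocomplement = mk⇔
      (λ h → (λ x → proj₁ (h x))
           , antisym (𝟏-maximum _) (proj₂ (h 𝟎) 𝟏 (sym (𝟎-minimum 𝟏)))
           , λ x z → proj₂ (h x) _ (trans (sym (∧-assoc x z _)) (proj₁ (h (x ∧ z)))))
      (λ (a , b , d) x → a x , λ z x∧z≈𝟎 →
         ≤-trans (≤-reflexive (trans (𝟏-maximum z) (∧-congˡ (sym (trans (*-cong x∧z≈𝟎) b)))))
                 (d x z))

  module _ (_⁺ : Carrier → Carrier) (⁺-cong : ∀ {x y} → x ≈ y → (x ⁺) ≈ (y ⁺)) where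

    dualPseudocomplement :
      IsDualPseudocomplement A _⁺ ⇔
      ((∀ x → x ∨ (x ⁺) ≈ 𝟏) × ((𝟏 ⁺) ≈ 𝟎) × (∀ x z → (x ⁺) ≤ z ∨ ((x ∨ z) ⁺)))
    dualPseudocomplement = mk⇔
      (λ h → (λ x → proj₁ (h x))
           , antisym (proj₂ (h 𝟏) 𝟎 (trans (∨-comm 𝟏 𝟎) (≤⇒∨≈ (𝟎-minimum 𝟏)))) (𝟎-minimum _)
           , λ x z → proj₂ (h x) _ (trans (sym (∨-assoc x z _)) (proj₁ (h (x ∨ z)))))
      (λ (a , b , d) x → a x , λ z x∨z≈𝟏 →
         ≤-trans (d x z)
                 (≤-reflexive (trans (∨-congˡ (trans (⁺-cong x∨z≈𝟏) b))
                                   (trans (∨-comm z 𝟎) (≤⇒∨≈ (𝟎-minimum z))))))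

  module _ (_⇨_ : Carrier → Carrier → Carrier) (⇨-cong : ∀ {x y z} → y ≈ z → (x ⇨ y) ≈ (x ⇨ z))
    where

    implication :
      IsImplication A _⇨_ ⇔
      ((∀ x y → x ∧ (x ⇨ y) ≤ y) × (∀ x y z → z ≤ (x ⇨ ((x ∧ z) ∨ y))))
    implication = mk⇔
      (λ h → (λ x y → proj₁ (h x y)) , λ x y z → proj₂ (h x _) z (x≤x∨y _ _))
      (λ (a , b) x y → a x y , λ z x∧z≤y →
         ≤-trans (b x y z) (≤-reflexive (⇨-cong (≤⇒∨≈ x∧z≤y))))

  module _ (_⇦_ : Carrier → Carrier → Carrier) (⇦-cong : ∀ {x y z} → y ≈ z → (x ⇦ y) ≈ (x ⇦ z))
    where

    dualImplication :
      IsDualImplication A _⇦_ ⇔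
      ((∀ x y → y ≤ x ∨ (x ⇦ y)) × (∀ x y z → (x ⇦ (y ∧ (x ∨ z))) ≤ z))
    dualImplication = mk⇔
      (λ h → (λ x y → proj₁ (h x y)) , λ x y z → proj₂ (h x _) z (x∧y≤y _ _))
      (λ (a , b) x y → a x y , λ z y≤x∨z →
         ≤-trans (≤-reflexive (⇦-cong y≤x∨z)) (b x y z))

RDMP : ∀ c ℓ → Variety DMP c ℓ (c ⊔ ℓ)
RDMP c ℓ = record { class = IsRDMP ; isVariety = relative deMorgan-isVariety axioms correct }
  where
  open DMPOperations (termAlgebra DMP)

  axioms : List (Identity DMP)
  axioms
    = (x₀ ∧ x₀ * , 𝟎)
    ∷ (𝟎 * , 𝟏)
    ∷ (y₀ ∧ (x₀ ∧ y₀) * , (y₀ ∧ (x₀ ∧ y₀) *) ∧ x₀ *)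
    ∷ (regˡ (reduct (termAlgebra DMP)) _* x₀ y₀ , regʳ (reduct (termAlgebra DMP)) _* x₀ y₀)
    ∷ []

  correct : (A : Algebra DMP c ℓ) → IsDeMorgan (reduct A) →
            (IsPseudocomplement (reduct A) (DMPOperations._* A)
             × IsRegular (reduct A) (DMPOperations._* A)) ⇔ A ⊨ᴸ axioms
  correct A dm = mk⇔
    (λ (ps , reg) → let (a , b , d) = to char ps in
        (λ ρ → a (ρ 0)) ∷ (λ ρ → b) ∷ (λ ρ → d (ρ 0) (ρ 1)) ∷ (λ ρ → reg (ρ 0) (ρ 1)) ∷ [])
    (λ where
      (a ∷ b ∷ d ∷ reg ∷ []) →
          from char ( (λ x → a (env x x x)) , b (env A.𝟎 A.𝟎 A.𝟎) , (λ x z → d (env x z z)))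
        , (λ x y → reg (env x y y)))
    where
    module A = DMPOperations A
    char = Residuals.pseudocomplement (reduct A) dm A._*
             (λ p → Algebra.⟦⟧-cong A (inj₂ star) (p ∷ []))

RDMH : ∀ c ℓ → Variety DMH c ℓ (c ⊔ ℓ)
RDMH c ℓ = record { class = IsRDMH ; isVariety = relative deMorgan-isVariety axioms correct }
  where
  open DMHOperations (termAlgebra DMH)

  axioms : List (Identity DMH)
  axioms
    = (x₀ ∧ (x₀ ⇨ y₀) , (x₀ ∧ (x₀ ⇨ y₀)) ∧ y₀)
    ∷ (z₀ , z₀ ∧ (x₀ ⇨ ((x₀ ∧ z₀) ∨ y₀)))
    ∷ (regˡ (reduct (termAlgebra DMH)) _* x₀ y₀ , regʳ (reduct (termAlgebra DMH)) _* x₀ y₀)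
    ∷ []

  correct : (A : Algebra DMH c ℓ) → IsDeMorgan (reduct A) →
            (IsImplication (reduct A) (DMHOperations._⇨_ A)
             × IsRegular (reduct A) (DMHOperations._* A)) ⇔ A ⊨ᴸ axioms
  correct A dm = mk⇔
    (λ (im , reg) → let (a , b) = to char im in
        (λ ρ → a (ρ 0) (ρ 1)) ∷ (λ ρ → b (ρ 0) (ρ 1) (ρ 2)) ∷ (λ ρ → reg (ρ 0) (ρ 1)) ∷ [])
    (λ where
      (a ∷ b ∷ reg ∷ []) →
          from char ((λ x y → a (env x y y)) , (λ x y z → b (env x y z)))
        , (λ x y → reg (env x y y)))
    where
    module A = DMHOperations A
    char = Residuals.implication (reduct A) dm A._⇨_
             (λ p → Algebra.⟦⟧-cong A (inj₂ imp) (A.refl ∷ p ∷ []))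

RDMDblH : ∀ c ℓ → Variety DMDblH c ℓ (c ⊔ ℓ)
RDMDblH c ℓ = record { class = IsRDMDblH ; isVariety = relative deMorgan-isVariety axioms correct }
  where
  open DMDblHOperations (termAlgebra DMDblH)

  axioms : List (Identity DMDblH)
  axioms
    = (x₀ ∧ (x₀ ⇨ y₀) , (x₀ ∧ (x₀ ⇨ y₀)) ∧ y₀)
    ∷ (z₀ , z₀ ∧ (x₀ ⇨ ((x₀ ∧ z₀) ∨ y₀)))
    ∷ (y₀ , y₀ ∧ (x₀ ∨ (x₀ ⇦ y₀)))
    ∷ (x₀ ⇦ (y₀ ∧ (x₀ ∨ z₀)) , (x₀ ⇦ (y₀ ∧ (x₀ ∨ z₀))) ∧ z₀)
    ∷ (regˡ (reduct (termAlgebra DMDblH)) _* x₀ y₀ , regʳ (reduct (termAlgebra DMDblH)) _* x₀ y₀)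
    ∷ []

  correct : (A : Algebra DMDblH c ℓ) → IsDeMorgan (reduct A) →
            (IsImplication (reduct A) (DMDblHOperations._⇨_ A)
             × IsDualImplication (reduct A) (DMDblHOperations._⇦_ A)
             × IsRegular (reduct A) (DMDblHOperations._* A)) ⇔ A ⊨ᴸ axioms
  correct A dm = mk⇔
    (λ (im , di , reg) → let (a , b) = to char im ; (a′ , b′) = to char′ di in
        (λ ρ → a (ρ 0) (ρ 1)) ∷ (λ ρ → b (ρ 0) (ρ 1) (ρ 2))
      ∷ (λ ρ → a′ (ρ 0) (ρ 1)) ∷ (λ ρ → b′ (ρ 0) (ρ 1) (ρ 2))
      ∷ (λ ρ → reg (ρ 0) (ρ 1)) ∷ [])
    (λ where
      (a ∷ b ∷ a′ ∷ b′ ∷ reg ∷ []) →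
          from char ((λ x y → a (env x y y)) , (λ x y z → b (env x y z)))
        , from char′ ((λ x y → a′ (env x y y)) , (λ x y z → b′ (env x y z)))
        , (λ x y → reg (env x y y)))
    where
    module A = DMDblHOperations A
    char = Residuals.implication (reduct A) dm A._⇨_
             (λ p → Algebra.⟦⟧-cong A (inj₂ imp) (A.refl ∷ p ∷ []))
    char′ = Residuals.dualImplication (reduct A) dm A._⇦_
             (λ p → Algebra.⟦⟧-cong A (inj₂ dimp) (A.refl ∷ p ∷ []))

RDMDblP : ∀ c ℓ → Variety DMDblP c ℓ (c ⊔ ℓ)
RDMDblP c ℓ = record { class = IsRDMDblP ; isVariety = relative deMorgan-isVariety axioms correct }
  where
  open DMDblPOperations (termAlgebra DMDblP)

  axioms : List (Identity DMDblP)
  axioms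
    = (x₀ ∧ x₀ * , 𝟎)
    ∷ (𝟎 * , 𝟏)
    ∷ (y₀ ∧ (x₀ ∧ y₀) * , (y₀ ∧ (x₀ ∧ y₀) *) ∧ x₀ *)
    ∷ (x₀ ∨ x₀ ⁺ , 𝟏)
    ∷ (𝟏 ⁺ , 𝟎)
    ∷ (x₀ ⁺ , x₀ ⁺ ∧ (y₀ ∨ (x₀ ∨ y₀) ⁺))
    ∷ (regˡ (reduct (termAlgebra DMDblP)) _* x₀ y₀ , regʳ (reduct (termAlgebra DMDblP)) _* x₀ y₀)
    ∷ []

  correct : (A : Algebra DMDblP c ℓ) → IsDeMorgan (reduct A) →
            (IsPseudocomplement (reduct A) (DMDblPOperations._* A)
             × IsDualPseudocomplement (reduct A) (DMDblPOperations._⁺ A)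
             × IsRegular (reduct A) (DMDblPOperations._* A)) ⇔ A ⊨ᴸ axioms
  correct A dm = mk⇔
    (λ (ps , dp , reg) → let (a , b , d) = to char ps ; (a′ , b′ , d′) = to char′ dp in
        (λ ρ → a (ρ 0)) ∷ (λ ρ → b) ∷ (λ ρ → d (ρ 0) (ρ 1))
      ∷ (λ ρ → a′ (ρ 0)) ∷ (λ ρ → b′) ∷ (λ ρ → d′ (ρ 0) (ρ 1))
      ∷ (λ ρ → reg (ρ 0) (ρ 1)) ∷ [])
    (λ where
      (a ∷ b ∷ d ∷ a′ ∷ b′ ∷ d′ ∷ reg ∷ []) →
          from char ((λ x → a (env x x x)) , b (env A.𝟎 A.𝟎 A.𝟎) , (λ x z → d (env x z z)))
        , from char′ ((λ x → a′ (env x x x)) , b′ (env A.𝟎 A.𝟎 A.𝟎) , (λ x z → d′ (env x z z)))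
        , (λ x y → reg (env x y y)))
    where
    module A = DMDblPOperations A
    char = Residuals.pseudocomplement (reduct A) dm A._*
             (λ p → Algebra.⟦⟧-cong A (inj₂ star) (p ∷ []))
    char′ = Residuals.dualPseudocomplement (reduct A) dm A._⁺
             (λ p → Algebra.⟦⟧-cong A (inj₂ plus) (p ∷ []))

{-# OPTIONS --safe #-}

-- The four varieties are term equivalent over their common De Morgan reduct, and
-- a term equivalence of varieties induces an isomorphism of their lattices of
-- subvarieties.  Both dual operations are obtained by De Morgan duality:
-- x ⁺ = x ′ * ′ and x ⇦ y = (x ′ ⇨ y ′) ′.  With x ⁺ = x ′ * ′ the regularity
-- identity reads x ∧ x ⁺ ≤ y ∨ y *, so x ≤ y as soon as x ∧ y * ≈ 𝟎 and
-- y ∨ x ⁺ ≈ 𝟏; this makes a term in * and ′ (a variant of Katriňák's) the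
-- relative pseudocomplement.  Extremal elements being unique, translating back
-- and forth returns the original operations.
module Submission where

open import Defs
open import Level using (Level; _⊔_) renaming (suc to lsuc)
open import Algebra.Lattice.Bundles using () renaming (Lattice to AlgLattice)
open import Algebra.Lattice.Structures using (IsDistributiveLattice)
import Algebra.Lattice.Properties.Lattice as LatticeProperties
open import Data.Nat.Base using (ℕ; zero; suc)
open import Data.Product.Base using (∃-syntax; _×_; _,_; proj₁; proj₂)
open import Data.Sum.Base using (inj₁; inj₂)
open import Data.Vec.Base using (Vec; []; _∷_)
open import Data.Vec.Relation.Binary.Pointwise.Inductive using (Pointwise; []; _∷_)
open import Function.Base using (_∘_; id)
open import Function.Bundles using (_⇔_; mk⇔; Equivalence)
open import Relation.Binary.Core using (_Preserves_⟶_)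
open import Relation.Binary.Lattice.Bundles using (Lattice)
import Relation.Binary.Lattice as R
import Relation.Binary.Lattice.Properties.JoinSemilattice as JoinSemilatticeProperties
import Relation.Binary.Lattice.Properties.MeetSemilattice as MeetSemilatticeProperties
open import Relation.Binary.PropositionalEquality using (_≡_; refl)
open import Relation.Unary using (Pred; _∩_; _∪_; _⊆′_; _≐′_)

open Equivalence using (to; from)

private
  variable
    a b c d k ℓ ℓ₁ ℓ₂ ℓ₃ ℓ₄ : Level

-- Lattice isomorphisms from monotone inverse maps.

module _ (L : Lattice a ℓ₁ ℓ₂) (M : Lattice b ℓ₃ ℓ₄) where
  private
    module L = Lattice L
    module M = Lattice M

  -- Mutually inverse monotone maps are adjoint to each other on both sides, and the adjunctions
  -- carry greatest lower and least upper bounds across.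
  order-isomorphism⇒≅ :
    (f : L.Carrier → M.Carrier) (g : M.Carrier → L.Carrier) →
    (∀ {x y} → x L.≤ y → f x M.≤ f y) → (∀ {x y} → x M.≤ y → g x L.≤ g y) →
    (∀ x → g (f x) L.≈ x) → (∀ y → f (g y) M.≈ y) → L ≅ M
  order-isomorphism⇒≅ f g f-mono g-mono gf fg = f , record
    { isLatticeMonomorphism = record
      { isLatticeHomomorphism = record
        { isRelHomomorphism = record { cong = f-cong }
        ; ∧-homo = λ x y → M.antisym
            (M.∧-greatest (f-mono (L.x∧y≤x x y)) (f-mono (L.x∧y≤y x y)))
            (f-adjoint (L.∧-greatest (g-adjoint (M.x∧y≤x _ _)) (g-adjoint (M.x∧y≤y _ _))))
        ; ∨-homo = λ x y → M.antisym
            (f-adjoint′ (L.∨-least (g-adjoint′ (M.x≤x∨y _ _)) (g-adjoint′ (M.y≤x∨y _ _))))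
            (M.∨-least (f-mono (L.x≤x∨y x y)) (f-mono (L.y≤x∨y x y)))
        }
      ; injective = λ {x} {y} fx≈fy → L.Eq.trans (L.Eq.sym (gf x))
          (L.Eq.trans (L.antisym (g-mono (M.reflexive fx≈fy)) (g-mono (M.reflexive (M.Eq.sym fx≈fy))))
                      (gf y))
      }
    ; surjective = λ y → g y , λ z≈gy → M.Eq.trans (f-cong z≈gy) (fg y)
    }
    where
    f-cong : ∀ {x y} → x L.≈ y → f x M.≈ f y
    f-cong x≈y = M.antisym (f-mono (L.reflexive x≈y)) (f-mono (L.reflexive (L.Eq.sym x≈y)))
    f-adjoint : ∀ {x y} → g y L.≤ x → y M.≤ f x
    f-adjoint p = M.trans (M.reflexive (M.Eq.sym (fg _))) (f-mono p)
    f-adjoint′ : ∀ {x y} → x L.≤ g y → f x M.≤ y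
    f-adjoint′ p = M.trans (f-mono p) (M.reflexive (fg _))
    g-adjoint : ∀ {x y} → y M.≤ f x → g y L.≤ x
    g-adjoint p = L.trans (g-mono p) (L.reflexive (gf _))
    g-adjoint′ : ∀ {x y} → f x M.≤ y → x L.≤ g y
    g-adjoint′ p = L.trans (L.reflexive (L.Eq.sym (gf _))) (g-mono p)

-- Homomorphisms and preservation of identities.

module _ {S : Signature} (A : Algebra S a ℓ₁) (B : Algebra S b ℓ₂) where
  private
    module A = Algebra A
    module B = Algebra B

  -- Relational form, so that no map over the argument vector is needed.
  IsHomomorphism : (A.Carrier → B.Carrier) → Set (a ⊔ b ⊔ ℓ₂)
  IsHomomorphism h = ∀ f {xs ys} → Pointwise (λ x y → h x B.≈ y) xs ys → h (A.⟦ f ⟧ xs) B.≈ B.⟦ f ⟧ ys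

  module _ {h : A.Carrier → B.Carrier} (hom : IsHomomorphism h)
           {σ : ℕ → A.Carrier} {ρ : ℕ → B.Carrier} (σ∼ρ : ∀ i → h (σ i) B.≈ ρ i) where
    mutual
      eval-homo : ∀ t → h (eval A σ t) B.≈ eval B ρ t
      eval-homo (var i)    = σ∼ρ i
      eval-homo (app f ts) = hom f (evals-homo ts)

      evals-homo : ∀ {n} (ts : Vec (Term S) n) →
                   Pointwise (λ x y → h x B.≈ y) (evals A σ ts) (evals B ρ ts)
      evals-homo []       = []
      evals-homo (t ∷ ts) = eval-homo t ∷ evals-homo ts

eval-isHomomorphism : ∀ {S} (A : Algebra S c ℓ) ρ → IsHomomorphism (termAlgebra S) A (eval A ρ)
eval-isHomomorphism A ρ f ts∼xs = ⟦⟧-cong f (pointwise ts∼xs)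
  where
  open Algebra A
  pointwise : ∀ {n} {ts : Vec _ n} {xs : Vec Carrier n} →
              Pointwise (λ t x → eval A ρ t ≈ x) ts xs → Pointwise _≈_ (evals A ρ ts) xs
  pointwise []       = []
  pointwise (p ∷ ps) = p ∷ pointwise ps

module _ {S : Signature} (A : Algebra S a ℓ₁) (B : Algebra S b ℓ₂) where
  private
    module A = Algebra A
    module B = Algebra B

  -- A valuation in `B` is lifted to `A` through the section `g`; the equation holds there and is
  -- pushed forward along `h`.
  ⊨-image : ∀ {h} → IsHomomorphism A B h → h Preserves A._≈_ ⟶ B._≈_ →
            (g : B.Carrier → A.Carrier) → (∀ y → h (g y) B.≈ y) → ∀ e → A ⊨ e → B ⊨ e
  ⊨-image hom h-cong g hg (s , t) A⊨e ρ =
    B.trans (B.sym (eval-homo A B hom (hg ∘ ρ) s))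
            (B.trans (h-cong (A⊨e (g ∘ ρ))) (eval-homo A B hom (hg ∘ ρ) t))

-- Closure under homomorphic images, the easy half of Birkhoff's theorem. It is applied to identity
-- maps, where it says that a variety cannot separate two algebras on one carrier whose operations
-- agree up to `≈`.
variety-image : ∀ {S} {K : Pred (Algebra S c ℓ) k} → IsVariety K → (A B : Algebra S c ℓ) →
                let module A = Algebra A; module B = Algebra B in
                ∀ {h} → IsHomomorphism A B h → h Preserves A._≈_ ⟶ B._≈_ →
                (g : B.Carrier → A.Carrier) → (∀ y → h (g y) B.≈ y) → K A → K B
variety-image (E , K⇔E) A B hom h-cong g hg A∈K =
  from (K⇔E B) λ e i → ⊨-image A B hom h-cong g hg e (to (K⇔E A) A∈K e i)

-- Interpretations of one expansion of De Morgan algebras in another.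

-- The i-th argument; positions beyond the arity get the junk value 𝟎.
arguments : (A : Algebra DM c ℓ) → ∀ {n} → Vec (Algebra.Carrier A) n → ℕ → Algebra.Carrier A
arguments A []       _       = DMOperations.𝟎 A
arguments A (x ∷ xs) zero    = x
arguments A (x ∷ xs) (suc i) = arguments A xs i

-- The variables below its arity stand for the arguments of an operation.
record Interpretation (T T′ : Signature) : Set where
  constructor interpretation
  field
    definition : Op T → Term (DM ⊕ T′)

open Interpretation

module _ {T T′ : Signature} (I : Interpretation T T′) where

  interpret : Algebra (DM ⊕ T′) c ℓ → Algebra (DM ⊕ T) c ℓ
  interpret A = record
    { carrier = carrier
    ; ⟦_⟧     = λ where
        (inj₁ f) → ⟦ inj₁ f ⟧
        (inj₂ f) xs → eval A (arguments (reduct A) xs) (definition I f)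
    ; ⟦⟧-cong = λ where
        (inj₁ f) → ⟦⟧-cong (inj₁ f)
        -- `⟦⟧-cong` says precisely that the identity map is a homomorphism from `A` to itself.
        (inj₂ f) ps → eval-homo A A ⟦⟧-cong (arguments-cong ps) (definition I f)
    }
    where
    open Algebra A
    arguments-cong : ∀ {n} {xs ys : Vec Carrier n} → Pointwise _≈_ xs ys →
                     ∀ i → arguments (reduct A) xs i ≈ arguments (reduct A) ys i
    arguments-cong []       _       = Algebra.refl A
    arguments-cong (p ∷ ps) zero    = p
    arguments-cong (p ∷ ps) (suc i) = arguments-cong ps i

  interpret-isHomomorphism : (A : Algebra (DM ⊕ T′) a ℓ₁) (B : Algebra (DM ⊕ T′) b ℓ₂) → ∀ {h} →
    IsHomomorphism A B h → IsHomomorphism (interpret A) (interpret B) h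
  interpret-isHomomorphism A B {h} hom (inj₁ f) ps = hom (inj₁ f) ps
  interpret-isHomomorphism A B {h} hom (inj₂ f) ps = eval-homo A B hom (arguments-homo ps) (definition I f)
    where
    module B = Algebra B
    arguments-homo : ∀ {n} {xs : Vec _ n} {ys : Vec _ n} → Pointwise (λ x y → h x B.≈ y) xs ys →
                     ∀ i → h (arguments (reduct A) xs i) B.≈ arguments (reduct B) ys i
    -- The junk value is a constant of the signature, so `h` preserves it too.
    arguments-homo []       _       = hom (inj₁ bot) []
    arguments-homo (p ∷ ps) zero    = p
    arguments-homo (p ∷ ps) (suc i) = arguments-homo ps i

  -- Substituting definitions into a term is evaluation in the reinterpreted term algebra, so the
  -- facts about `eval` apply to translation.
  translate : Term (DM ⊕ T) → Term (DM ⊕ T′)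
  translate = eval (interpret (termAlgebra (DM ⊕ T′))) var

  -- `eval A ρ` is a homomorphism from the term algebra and remains one after both sides are
  -- reinterpreted; on variables it agrees with `ρ`.
  eval-translate : (A : Algebra (DM ⊕ T′) c ℓ) → ∀ ρ t →
                   Algebra._≈_ A (eval A ρ (translate t)) (eval (interpret A) ρ t)
  eval-translate A ρ = eval-homo (interpret (termAlgebra (DM ⊕ T′))) (interpret A)
    (interpret-isHomomorphism (termAlgebra (DM ⊕ T′)) A (eval-isHomomorphism A ρ))
    (λ i → Algebra.refl A)

  ⊨-translate : (A : Algebra (DM ⊕ T′) c ℓ) → ∀ s t →
                A ⊨ (translate s , translate t) ⇔ interpret A ⊨ (s , t)
  ⊨-translate A s t = mk⇔
    (λ m ρ → trans (sym (eval-translate A ρ s)) (trans (m ρ) (eval-translate A ρ t)))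
    (λ m ρ → trans (eval-translate A ρ s) (trans (m ρ) (sym (eval-translate A ρ t))))
    where open Algebra A

  -- The preimage is axiomatised by the image of `E` under `translate`, hence the existential form
  -- of the axiom set.
  interpret⁻¹-isVariety : {K : Pred (Algebra (DM ⊕ T) c ℓ) k} →
                          IsVariety K → IsVariety (K ∘ interpret)
  interpret⁻¹-isVariety (E , K⇔E) =
    (λ (s′ , t′) → ∃[ s ] ∃[ t ] E (s , t) × translate s ≡ s′ × translate t ≡ t′) , λ A → mk⇔
      (λ { KA _ (s , t , i , refl , refl) →
             from (⊨-translate A s t) (to (K⇔E (interpret A)) KA (s , t) i) })
      (λ m → from (K⇔E (interpret A)) λ (s , t) i →
             to (⊨-translate A s t) (m _ (s , t , i , refl , refl)))

-- Transport of subvarieties, and term equivalence.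

∩-isVariety : ∀ {S} {K : Pred (Algebra S c ℓ) k} {K′ : Pred (Algebra S c ℓ) d} →
              IsVariety K → IsVariety K′ → IsVariety (K ∩ K′)
∩-isVariety (E , K⇔E) (E′ , K′⇔E′) = (E ∪ E′) , λ A → mk⇔
  (λ where (a , b) e (inj₁ i) → to (K⇔E A) a e i
           (a , b) e (inj₂ i) → to (K′⇔E′ A) b e i)
  (λ m → from (K⇔E A) (λ e → m e ∘ inj₁) , from (K′⇔E′ A) (λ e → m e ∘ inj₂))

-- `interpret I` sends algebras against the direction of `I`, so its preimage sends subvarieties
-- along `I`. Intersecting with `class W` keeps the result inside `W`.
interpretSubvariety : ∀ {T T′} (I : Interpretation T T′) {V : Variety (DM ⊕ T) c ℓ (c ⊔ ℓ)}
                      (W : Variety (DM ⊕ T′) c ℓ (c ⊔ ℓ)) → Subvariety V → Subvariety W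
interpretSubvariety I W P = record
  { variety = record
    { class     = class W ∩ (members P ∘ interpret I)
    ; isVariety = ∩-isVariety (isVariety W) (interpret⁻¹-isVariety I (members-isVariety P))
    }
  ; ⊆V = λ A → proj₁
  }

interpretSubvariety-mono : ∀ {T T′} (I : Interpretation T T′) {V : Variety (DM ⊕ T) c ℓ (c ⊔ ℓ)}
                           (W : Variety (DM ⊕ T′) c ℓ (c ⊔ ℓ)) (P Q : Subvariety V) →
                           members P ⊆′ members Q →
                           members (interpretSubvariety I W P) ⊆′ members (interpretSubvariety I W Q)
interpretSubvariety-mono I W P Q P⊆Q A (A∈W , IA∈P) = A∈W , P⊆Q (interpret I A) IA∈P

-- One half of a term equivalence; the other half exchanges the roles of `V` and `W`. Only the extra
-- operations appear in `round`, because interpretations leave the De Morgan operations fixed.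
record IsTermRetraction {T T′} (V : Variety (DM ⊕ T) c ℓ (c ⊔ ℓ)) (W : Variety (DM ⊕ T′) c ℓ (c ⊔ ℓ))
                        (I : Interpretation T T′) (J : Interpretation T′ T) : Set (lsuc (c ⊔ ℓ)) where
  field
    sound : ∀ A → class V A → class W (interpret J A)
    round : ∀ A → class V A → ∀ f xs →
            Algebra._≈_ A (Algebra.⟦_⟧ (interpret I (interpret J A)) (inj₂ f) xs) (Algebra.⟦_⟧ A (inj₂ f) xs)

  private module _ (A : Algebra (DM ⊕ T) c ℓ) (A∈V : class V A) where
    open Algebra A

    round-isHomomorphism : IsHomomorphism (interpret I (interpret J A)) A id
    round-isHomomorphism (inj₁ f) ps = ⟦⟧-cong (inj₁ f) ps
    round-isHomomorphism (inj₂ f) ps = trans (round A A∈V f _) (⟦⟧-cong (inj₂ f) ps)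

    round⁻¹-isHomomorphism : IsHomomorphism A (interpret I (interpret J A)) id
    round⁻¹-isHomomorphism (inj₁ f) ps = ⟦⟧-cong (inj₁ f) ps
    round⁻¹-isHomomorphism (inj₂ f) ps = trans (⟦⟧-cong (inj₂ f) ps) (sym (round A A∈V f _))

  -- The identity map is a homomorphism both ways between `A` and its double reinterpretation, so
  -- both lie in the same varieties.
  roundTrip : (P : Subvariety V) →
              members (interpretSubvariety J V (interpretSubvariety I W P)) ≐′ members P
  roundTrip P =
      (λ A (A∈V , _ , A∈P) → variety-image (members-isVariety P) (interpret I (interpret J A)) A
         (round-isHomomorphism A A∈V) id id (λ _ → Algebra.refl A) A∈P)
    , (λ A A∈P → let A∈V = ⊆V P A A∈P in
         A∈V , sound A A∈V
             , variety-image (members-isVariety P) A (interpret I (interpret J A))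
                 (round⁻¹-isHomomorphism A A∈V) id id (λ _ → Algebra.refl A) A∈P)

-- Terms for the derived operations.

module _ (A : Algebra DM c ℓ) where
  open DMOperations A

  dualPseudocomplementOf : (Carrier → Carrier) → Carrier → Carrier
  dualPseudocomplementOf _* x = ((x ′) *) ′

  dualImplicationOf : (Carrier → Carrier → Carrier) → Carrier → Carrier → Carrier
  dualImplicationOf _⇨_ x y = ((x ′) ⇨ (y ′)) ′

  -- For u the meet of x with this term, the first factor forces u ∧ y * ≈ 𝟎 and the second forces y
  -- ∨ u ⁺ ≈ 𝟏, the two hypotheses of `regular⇒≤`.
  implicationOf : (Carrier → Carrier) → Carrier → Carrier → Carrier
  implicationOf _* x y =
    ((x ∧ (y *)) *) ∧ (dualPseudocomplementOf _* (x ∨ (x *)) ∨ ((x *) ∨ y))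

-- Residuals and their duals in De Morgan algebras.

module DeMorganProperties (A : Algebra DM c ℓ) (dm : IsDeMorgan A) where
  open DMOperations A
  open IsDeMorgan dm
  open IsDistributiveLattice isDistributiveLattice
    using (isLattice; ∧-congˡ; ∧-distribˡ-∨; ∨-cong; ∨-congˡ; ∨-congʳ)
  private
    algebraicLattice : AlgLattice _ _
    algebraicLattice = record { isLattice = isLattice }
  open LatticeProperties algebraicLattice using (∨-∧-orderTheoreticLattice)
  open R.Lattice ∨-∧-orderTheoreticLattice
    using (x∧y≤x; x∧y≤y; x≤x∨y; y≤x∨y; ∧-greatest; ∨-least; antisym; joinSemilattice; meetSemilattice)
    renaming (trans to ≤-trans; reflexive to ≤-reflexive; refl to ≤-refl)
  open JoinSemilatticeProperties joinSemilattice using (∨-monotonic)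
  open MeetSemilatticeProperties meetSemilattice using (∧-monotonic)

  ′-cong : ∀ {x y} → x ≈ y → x ′ ≈ y ′
  ′-cong x≈y = ⟦⟧-cong neg (x≈y ∷ [])

  ′-antitone : ∀ {x y} → x ≤ y → y ′ ≤ x ′
  ′-antitone {x} {y} x≤y = ≤-trans (y≤x∨y _ _)
    (≤-reflexive (trans (sym (′-∧ x y)) (′-cong (sym x≤y))))

  ′-transposeˡ : ∀ {x y} → x ′ ≤ y → y ′ ≤ x
  ′-transposeˡ p = ≤-trans (′-antitone p) (≤-reflexive (′-involutive _))

  ′-transposeʳ : ∀ {x y} → x ≤ y ′ → y ≤ x ′
  ′-transposeʳ p = ≤-trans (≤-reflexive (sym (′-involutive _))) (′-antitone p)

  ≤𝟎⇒≈𝟎 : ∀ {x} → x ≤ 𝟎 → x ≈ 𝟎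
  ≤𝟎⇒≈𝟎 x≤𝟎 = antisym x≤𝟎 (𝟎-minimum _)

  𝟏≤⇒≈𝟏 : ∀ {x} → 𝟏 ≤ x → x ≈ 𝟏
  𝟏≤⇒≈𝟏 𝟏≤x = antisym (𝟏-maximum _) 𝟏≤x

  -- Case distinction by distributivity: x is the join of x ∧ p and x ∧ q.
  cut : ∀ {x y p q} → x ≤ p ∨ q → x ∧ p ≤ y → x ∧ q ≤ y → x ≤ y
  cut {x} {p = p} {q} x≤p∨q x∧p≤y x∧q≤y =
    ≤-trans (≤-reflexive (trans x≤p∨q (∧-distribˡ-∨ x p q))) (∨-least x∧p≤y x∧q≤y)

  largest-unique : ∀ {p} {P : Pred Carrier p} {m n} → IsLargest A P m → IsLargest A P n → m ≈ n
  largest-unique (Pm , m-max) (Pn , n-max) = antisym (n-max _ Pm) (m-max _ Pn)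

  least-unique : ∀ {p} {P : Pred Carrier p} {m n} → IsLeast A P m → IsLeast A P n → m ≈ n
  least-unique (Pm , m-min) (Pn , n-min) = antisym (m-min _ Pn) (n-min _ Pm)

  -- Needed because translation replaces the * of (M1) by a term that equals it only up to `≈`.
  regular-resp-≈ : ∀ {f g} → (∀ x → f x ≈ g x) → IsRegular A f → IsRegular A g
  regular-resp-≈ f≈g reg x y =
    trans (∨-cong (∧-congˡ (′-cong (sym (f≈g (x ′))))) (∨-congˡ (sym (f≈g y))))
          (trans (reg x y) (∨-congˡ (f≈g y)))

  implication⇒pseudocomplement : ∀ {_⇨_} → IsImplication A _⇨_ → IsPseudocomplement A (_⇨ 𝟎)
  implication⇒pseudocomplement im x =
    ≤𝟎⇒≈𝟎 (proj₁ (im x 𝟎)) , λ z x∧z≈𝟎 → proj₂ (im x 𝟎) z (≤-reflexive x∧z≈𝟎)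

  dualImplication⇒dualPseudocomplement :
    ∀ {_⇦_} → IsDualImplication A _⇦_ → IsDualPseudocomplement A (_⇦ 𝟏)
  dualImplication⇒dualPseudocomplement di x =
    𝟏≤⇒≈𝟏 (proj₁ (di x 𝟏)) , λ z x∨z≈𝟏 → proj₂ (di x 𝟏) z (≤-reflexive (sym x∨z≈𝟏))

  implication⇒dualImplication :
    ∀ {_⇨_} → IsImplication A _⇨_ → IsDualImplication A (dualImplicationOf A _⇨_)
  implication⇒dualImplication im x y =
      ≤-trans (′-transposeʳ (proj₁ (im (x ′) (y ′))))
              (≤-reflexive (trans (′-∧ _ _) (∨-congʳ (′-involutive x))))
    , λ z y≤x∨z → ′-transposeˡ (proj₂ (im (x ′) (y ′)) (z ′)
        (≤-trans (≤-reflexive (sym (′-∨ x z))) (′-antitone y≤x∨z)))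

  module _ {_* : Carrier → Carrier} (pc : IsPseudocomplement A _*) where
    private
      _⁺ : Carrier → Carrier
      _⁺ = dualPseudocomplementOf A _*

    pseudocomplement⇒dualPseudocomplement : IsDualPseudocomplement A _⁺
    pseudocomplement⇒dualPseudocomplement x =
        trans (∨-congʳ (sym (′-involutive x)))
              (trans (sym (′-∧ _ _)) (trans (′-cong (proj₁ (pc (x ′)))) 𝟎′≈𝟏))
      , λ z x∨z≈𝟏 → ′-transposeˡ (proj₂ (pc (x ′)) (z ′)
          (trans (sym (′-∨ x z)) (trans (′-cong x∨z≈𝟏) 𝟏′≈𝟎)))

    -- Relative pseudocomplements from regularity.

    module _ (regular : IsRegular A _*) where
      private
        x∧x*≤𝟎 : ∀ x → x ∧ (x *) ≤ 𝟎
        x∧x*≤𝟎 x = ≤-reflexive (proj₁ (pc x))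

        𝟏≤x∨x⁺ : ∀ x → 𝟏 ≤ x ∨ (x ⁺)
        𝟏≤x∨x⁺ x = ≤-reflexive (sym (proj₁ (pseudocomplement⇒dualPseudocomplement x)))

        ⁺-least : ∀ {x z} → 𝟏 ≤ x ∨ z → (x ⁺) ≤ z
        ⁺-least p = proj₂ (pseudocomplement⇒dualPseudocomplement _) _ (𝟏≤⇒≈𝟏 p)

      regular⇒≤ : ∀ {x y} → x ∧ (y *) ≤ 𝟎 → 𝟏 ≤ y ∨ (x ⁺) → x ≤ y
      -- Split x along y ∨ x ⁺. The part in x ⁺ is x ∧ x ⁺, which regularity places below y ∨ y *;
      -- its share in y * vanishes.
      regular⇒≤ {x} {y} x∧y*≤𝟎 𝟏≤y∨x⁺ = cut (≤-trans (𝟏-maximum x) 𝟏≤y∨x⁺) (x∧y≤y _ _)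
        (cut (≤-trans (x≤x∨y _ _) (≤-reflexive (regular x y))) (x∧y≤y _ _)
             (≤-trans (∧-monotonic (x∧y≤x _ _) ≤-refl) (≤-trans x∧y*≤𝟎 (𝟎-minimum y))))

      regular⇒implication : IsImplication A (implicationOf A _*)
      regular⇒implication x y = regular⇒≤ u∧y*≤𝟎 𝟏≤y∨u⁺ , λ z x∧z≤y → ∧-greatest
        (proj₂ (pc (x ∧ (y *))) z (≤𝟎⇒≈𝟎
          (≤-trans (∧-greatest (≤-trans (∧-monotonic (x∧y≤x _ _) ≤-refl) x∧z≤y)
                               (≤-trans (x∧y≤x _ _) (x∧y≤y _ _)))
                   (x∧x*≤𝟎 y))))
        -- Split z along x, x * and (x ∨ x *) ⁺, whose join is 𝟏: the first part lies below y by
        -- assumption, the other two below their own disjuncts of the second factor.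
        (cut (≤-trans (𝟏-maximum z) (𝟏≤x∨x⁺ (x ∨ (x *))))
             (cut (x∧y≤y _ _)
                  (≤-trans (∧-greatest (x∧y≤y _ _) (≤-trans (x∧y≤x _ _) (x∧y≤x _ _)))
                           (≤-trans x∧z≤y (≤-trans (y≤x∨y _ _) (y≤x∨y _ _))))
                  (≤-trans (x∧y≤y _ _) (≤-trans (x≤x∨y _ _) (y≤x∨y _ _))))
             (≤-trans (x∧y≤y _ _) (x≤x∨y _ _)))
        where
        u = x ∧ implicationOf A _* x y

        u≤x : u ≤ x
        u≤x = x∧y≤x _ _

        u∧y*≤𝟎 : u ∧ (y *) ≤ 𝟎
        -- The first factor puts u ∧ y * below both x ∧ y * and its pseudocomplement.
        u∧y*≤𝟎 = ≤-trans
          (∧-greatest (∧-monotonic u≤x ≤-refl)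
                      (≤-trans (x∧y≤x _ _) (≤-trans (x∧y≤y _ _) (x∧y≤x _ _))))
          (x∧x*≤𝟎 _)

        𝟏≤y∨u⁺ : 𝟏 ≤ y ∨ (u ⁺)
        -- As u ∨ u ⁺ ≈ 𝟏, it suffices that u ≤ y ∨ u ⁺. Split u along the second factor: (x ∨ x *)
        -- ⁺ ≤ u ⁺ since ⁺ is antitone and u ≤ x ∨ x *, while u ∧ x * vanishes since u ≤ x.
        𝟏≤y∨u⁺ = ≤-trans (𝟏≤x∨x⁺ u) (∨-least
          (cut (≤-trans (x∧y≤y _ _) (x∧y≤y _ _))
               (≤-trans (x∧y≤y _ _) (≤-trans
                 (⁺-least (≤-trans (𝟏≤x∨x⁺ u) (∨-monotonic (≤-trans u≤x (x≤x∨y _ _)) ≤-refl)))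
                 (y≤x∨y _ _)))
               (cut (x∧y≤y _ _)
                    (≤-trans (∧-monotonic (≤-trans (x∧y≤x _ _) u≤x) ≤-refl)
                             (≤-trans (x∧x*≤𝟎 x) (𝟎-minimum _)))
                    (≤-trans (x∧y≤y _ _) (x≤x∨y _ _))))
          (y≤x∨y _ _))

-- The interpretations between the four signatures.

P H DblH DblP : Signature
P    = record { Op = POp    ; arity = λ _ → 1 }
H    = record { Op = HOp    ; arity = λ _ → 2 }
DblH = record { Op = DblHOp ; arity = λ _ → 2 }
DblP = record { Op = DblPOp ; arity = λ _ → 1 }

P-in-H : Interpretation P H
P-in-H = interpretation λ where star → x₀ *
  where open DMHOperations (termAlgebra DMH)

H-in-P : Interpretation H P
H-in-P = interpretation λ where imp → implicationOf (reduct (termAlgebra DMP)) _* x₀ y₀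
  where open DMPOperations (termAlgebra DMP)

H-in-DblH : Interpretation H DblH
H-in-DblH = interpretation λ where imp → x₀ ⇨ y₀
  where open DMDblHOperations (termAlgebra DMDblH)

DblH-in-H : Interpretation DblH H
DblH-in-H = interpretation λ where
    imp  → x₀ ⇨ y₀
    dimp → dualImplicationOf (reduct (termAlgebra DMH)) _⇨_ x₀ y₀
  where open DMHOperations (termAlgebra DMH)

DblH-in-DblP : Interpretation DblH DblP
DblH-in-DblP = interpretation λ where
    imp  → implicationOf termDM _* x₀ y₀
    dimp → dualImplicationOf termDM (implicationOf termDM _*) x₀ y₀
  where
  open DMDblPOperations (termAlgebra DMDblP)
  termDM = reduct (termAlgebra DMDblP)

DblP-in-DblH : Interpretation DblP DblH
DblP-in-DblH = interpretation λ where
    star → x₀ *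
    -- This is the least z with 𝟏 ≤ x ∨ z.
    plus → x₀ ⇦ 𝟏
  where open DMDblHOperations (termAlgebra DMDblH)

-- Term retractions, in both directions, for each consecutive pair of varieties.

module _ {c ℓ : Level} where
  open DeMorganProperties

  RDMP-retractOf-RDMH : IsTermRetraction (RDMP c ℓ) (RDMH c ℓ) P-in-H H-in-P
  RDMP-retractOf-RDMH = record
    { sound = λ A (dm , pc , reg) →
          dm , regular⇒implication (reduct A) dm pc reg
             , regular-resp-≈ (reduct A) dm (*≈ A dm pc reg) reg
    ; round = λ { A (dm , pc , reg) star (x ∷ []) → Algebra.sym A (*≈ A dm pc reg x) }
    }
    where
    -- Both sides are pseudocomplements of x, the right one because `implicationOf` is an
    -- implication.
    *≈ : (A : Algebra DMP c ℓ) → let open DMPOperations A in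
         IsDeMorgan (reduct A) → IsPseudocomplement (reduct A) _* → IsRegular (reduct A) _* →
         ∀ x → x * ≈ implicationOf (reduct A) _* x 𝟎
    *≈ A dm pc reg x = largest-unique (reduct A) dm (pc x)
      (implication⇒pseudocomplement (reduct A) dm (regular⇒implication (reduct A) dm pc reg) x)

  RDMH-retractOf-RDMP : IsTermRetraction (RDMH c ℓ) (RDMP c ℓ) H-in-P P-in-H
  RDMH-retractOf-RDMP = record
    { sound = λ A (dm , im , reg) → dm , implication⇒pseudocomplement (reduct A) dm im , reg
    ; round = λ { A (dm , im , reg) imp (x ∷ y ∷ []) → largest-unique (reduct A) dm
        (regular⇒implication (reduct A) dm (implication⇒pseudocomplement (reduct A) dm im) reg x y)
        (im x y) }
    }

  RDMH-retractOf-RDMDblH : IsTermRetraction (RDMH c ℓ) (RDMDblH c ℓ) H-in-DblH DblH-in-H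
  RDMH-retractOf-RDMDblH = record
    { sound = λ A (dm , im , reg) → dm , im , implication⇒dualImplication (reduct A) dm im , reg
    ; round = λ { A _ imp (x ∷ y ∷ []) → Algebra.refl A }
    }

  RDMDblH-retractOf-RDMH : IsTermRetraction (RDMDblH c ℓ) (RDMH c ℓ) DblH-in-H H-in-DblH
  RDMDblH-retractOf-RDMH = record
    { sound = λ A (dm , im , di , reg) → dm , im , reg
    ; round = λ
        { A _ imp (x ∷ y ∷ []) → Algebra.refl A
        ; A (dm , im , di , reg) dimp (x ∷ y ∷ []) → least-unique (reduct A) dm
            (implication⇒dualImplication (reduct A) dm im x y) (di x y) }
    }

  RDMDblH-retractOf-RDMDblP : IsTermRetraction (RDMDblH c ℓ) (RDMDblP c ℓ) DblH-in-DblP DblP-in-DblH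
  RDMDblH-retractOf-RDMDblP = record
    { sound = λ A (dm , im , di , reg) →
          dm , implication⇒pseudocomplement (reduct A) dm im
             , dualImplication⇒dualPseudocomplement (reduct A) dm di , reg
    ; round = λ
        { A (dm , im , di , reg) imp (x ∷ y ∷ []) → largest-unique (reduct A) dm
            (regular⇒implication (reduct A) dm (implication⇒pseudocomplement (reduct A) dm im) reg x y)
            (im x y)
        ; A (dm , im , di , reg) dimp (x ∷ y ∷ []) → least-unique (reduct A) dm
            (implication⇒dualImplication (reduct A) dm
              (regular⇒implication (reduct A) dm (implication⇒pseudocomplement (reduct A) dm im) reg) x y)
            (di x y) }
    }

  RDMDblP-retractOf-RDMDblH : IsTermRetraction (RDMDblP c ℓ) (RDMDblH c ℓ) DblP-in-DblH DblH-in-DblP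
  RDMDblP-retractOf-RDMDblH = record
    { sound = λ A (dm , pc , dpc , reg) →
        let im = regular⇒implication (reduct A) dm pc reg in
          dm , im , implication⇒dualImplication (reduct A) dm im
             , regular-resp-≈ (reduct A) dm
                 (λ x → largest-unique (reduct A) dm (pc x)
                          (implication⇒pseudocomplement (reduct A) dm im x)) reg
    ; round = λ
        { A (dm , pc , dpc , reg) star (x ∷ []) → largest-unique (reduct A) dm
            (implication⇒pseudocomplement (reduct A) dm (regular⇒implication (reduct A) dm pc reg) x)
            (pc x)
        ; A (dm , pc , dpc , reg) plus (x ∷ []) → least-unique (reduct A) dm
            (dualImplication⇒dualPseudocomplement (reduct A) dm
              (implication⇒dualImplication (reduct A) dm (regular⇒implication (reduct A) dm pc reg)) x)
            (dpc x) }
    }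

corollary2p11 : (c ℓ : Level) →
    (𝓛ᵥ (RDMP c ℓ) ≅ 𝓛ᵥ (RDMH c ℓ)) ×
    (𝓛ᵥ (RDMH c ℓ) ≅ 𝓛ᵥ (RDMDblH c ℓ)) ×
    (𝓛ᵥ (RDMDblH c ℓ) ≅ 𝓛ᵥ (RDMDblP c ℓ))
corollary2p11 c ℓ =
    order-isomorphism⇒≅ (𝓛ᵥ (RDMP c ℓ)) (𝓛ᵥ (RDMH c ℓ))
      (interpretSubvariety P-in-H (RDMH c ℓ)) (interpretSubvariety H-in-P (RDMP c ℓ))
      (λ {X} {Y} → interpretSubvariety-mono P-in-H (RDMH c ℓ) X Y)
      (λ {X} {Y} → interpretSubvariety-mono H-in-P (RDMP c ℓ) X Y)
      (roundTrip RDMP-retractOf-RDMH) (roundTrip RDMH-retractOf-RDMP)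
  , order-isomorphism⇒≅ (𝓛ᵥ (RDMH c ℓ)) (𝓛ᵥ (RDMDblH c ℓ))
      (interpretSubvariety H-in-DblH (RDMDblH c ℓ)) (interpretSubvariety DblH-in-H (RDMH c ℓ))
      (λ {X} {Y} → interpretSubvariety-mono H-in-DblH (RDMDblH c ℓ) X Y)
      (λ {X} {Y} → interpretSubvariety-mono DblH-in-H (RDMH c ℓ) X Y)
      (roundTrip RDMH-retractOf-RDMDblH) (roundTrip RDMDblH-retractOf-RDMH)
  , order-isomorphism⇒≅ (𝓛ᵥ (RDMDblH c ℓ)) (𝓛ᵥ (RDMDblP c ℓ))
      (interpretSubvariety DblH-in-DblP (RDMDblP c ℓ)) (interpretSubvariety DblP-in-DblH (RDMDblH c ℓ))
      (λ {X} {Y} → interpretSubvariety-mono DblH-in-DblP (RDMDblP c ℓ) X Y)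
      (λ {X} {Y} → interpretSubvariety-mono DblP-in-DblH (RDMDblH c ℓ) X Y)
      (roundTrip RDMDblH-retractOf-RDMDblP) (roundTrip RDMDblP-retractOf-RDMDblH)
  where open IsTermRetraction
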